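{- For every positive integer $d$ there exists $N=N(d)$ such that for every integer $n\geq N$, every graph $\Gamma$ with vertex set $\{1,2,\dots,n\}$ and maximum degree at most $d$, and every prime $p>n^2$, every subset of size $n$ of $\mathbb{Z}_p\setminus\{0\}$ is $\Gamma$-sequenceable.
   Context: Let $\Gamma$ be a (simple) graph with vertex set $\{1,2,\dots,n\}$ and edge set $E(\Gamma)$. A subset $A$ of size $n$ of a group $G$ (written additively) is called $\Gamma$-sequenceable if there is an ordering $(v_1,\dots,v_n)$ of its elements such that the partial sums $s_0=0$ and $s_i=\sum_{j=1}^i v_j$ for $1\leq i\leq n$ satisfy $s_i\neq s_j$ whenever $\{i,j\}\in E(\Gamma)$. $\mathbb{Z}_p$ denotes the cyclic group of prime order $p$. -}

module Defs where

open import Algebra.Bundles using (Group)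
import Algebra.Properties.Monoid.Sum as MonoidSum
open import Data.Fin.Base using (Fin; suc; toℕ; Fin′; inject!)
open import Data.Fin.Properties using (toℕ-injective; toℕ-fromℕ<; toℕ<n)
open import Data.Nat.Base using (ℕ; _+_; _∸_; _⊔_; NonZero)
open import Data.Nat.DivMod using (_%_; _mod_; m%n<n; m<n⇒m%n≡m; n%n≡0; %-distribˡ-+; m%n%n≡m%n)
open import Data.Nat.Properties using (+-assoc; +-comm; m+[n∸m]≡n; <⇒≤)
open import Data.Product.Base using (∃; _×_; _,_)
import Data.Vec.Base as Vec
open import Data.Vec.Functional using (Vector; foldr)
open import Function.Definitions using (Injective)
open import Level using (Level; 0ℓ)
open import Relation.Binary.Core using (Rel)
open import Relation.Binary.Definitions using (Decidable; Irreflexive; Symmetric)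
open import Relation.Binary.PropositionalEquality
  using (_≡_; sym; trans; cong; cong₂; isEquivalence; module ≡-Reasoning)
open import Relation.Nullary.Negation.Core using (¬_)
open import Relation.Unary using (Pred; _∈_)

-- Vertex i of {1,…,n} is represented by the element of Fin n with toℕ equal
-- to i - 1.  Adjacency is decidable since the graph is a finite object.
record SimpleGraph (n : ℕ) : Set₁ where
  infix 4 _~_ _~?_
  field
    _~_    : Rel (Fin n) 0ℓ
    ~-sym  : Symmetric _~_
    ~-irr  : Irreflexive _≡_ _~_
    _~?_   : Decidable _~_

  degree : Fin n → ℕ
  degree i = Vec.count (i ~?_) (Vec.allFin n)

  maxDegree : ℕ
  maxDegree = foldr _⊔_ 0 degree

module _ {c ℓ : Level} (G : Group c ℓ) where
  open Group G
  open MonoidSum monoid using (sum)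

  -- An ordering of A with n terms; it exists only if A has exactly n elements.
  record IsOrdering {a} {n : ℕ} (A : Pred Carrier a) (v : Vector Carrier n) : Set (c Level.⊔ ℓ Level.⊔ a) where
    field
      distinct   : Injective _≡_ _≈_ v
      sound      : ∀ i → v i ∈ A
      exhaustive : ∀ {x} → x ∈ A → ∃ λ i → v i ≈ x

  -- The sum of the first toℕ i terms of v, in order.
  partialSum : ∀ {n} → Vector Carrier n → Fin (ℕ.suc n) → Carrier
  partialSum v i = sum λ (j : Fin′ i) → v (inject! j)

  -- By the indexing of vertices, the partial sum at vertex i has suc (toℕ i)
  -- terms; the empty sum corresponds to no vertex.
  Sequenceable : ∀ {a n} → SimpleGraph n → Pred Carrier a → Set (c Level.⊔ ℓ Level.⊔ a)
  Sequenceable {n = n} Γ A = ∃ λ (v : Vector Carrier n) →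
    IsOrdering A v ×
    (∀ {i j} → i ~ j → ¬ (partialSum v (suc i) ≈ partialSum v (suc j)))
    where open SimpleGraph Γ

module _ (m : ℕ) .{{_ : NonZero m}} where

  private
    infixl 6 _⊕_
    _⊕_ : Fin m → Fin m → Fin m
    x ⊕ y = (toℕ x + toℕ y) mod m

    neg : Fin m → Fin m
    neg x = (m ∸ toℕ x) mod m

    toℕ-mod : ∀ k → toℕ (k mod m) ≡ k % m
    toℕ-mod k = toℕ-fromℕ< (m%n<n k m)

    toℕ-% : (x : Fin m) → toℕ x % m ≡ toℕ x
    toℕ-% x = m<n⇒m%n≡m (toℕ<n x)

    mod-cong : ∀ {j k} → j % m ≡ k % m → j mod m ≡ k mod m
    mod-cong {j} {k} eq = toℕ-injective (trans (toℕ-mod j) (trans eq (sym (toℕ-mod k))))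

    mod-toℕ : ∀ x → toℕ x mod m ≡ x
    mod-toℕ x = toℕ-injective (trans (toℕ-mod (toℕ x)) (toℕ-% x))

    +-%ˡ : ∀ j k → (j % m + k) % m ≡ (j + k) % m
    +-%ˡ j k = begin
      (j % m + k) % m          ≡⟨ %-distribˡ-+ (j % m) k m ⟩
      (j % m % m + k % m) % m  ≡⟨ cong (λ t → (t + k % m) % m) (m%n%n≡m%n j m) ⟩
      (j % m + k % m) % m      ≡⟨ %-distribˡ-+ j k m ⟨
      (j + k) % m              ∎
      where open ≡-Reasoning

    mod-⊕ : ∀ j y → (j mod m) ⊕ y ≡ (j + toℕ y) mod m
    mod-⊕ j y = mod-cong (trans (cong (λ t → (t + toℕ y) % m) (toℕ-mod j)) (+-%ˡ j (toℕ y)))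

    ⊕-comm : ∀ x y → x ⊕ y ≡ y ⊕ x
    ⊕-comm x y = cong (_mod m) (+-comm (toℕ x) (toℕ y))

    ⊕-assoc : ∀ x y z → (x ⊕ y) ⊕ z ≡ x ⊕ (y ⊕ z)
    ⊕-assoc x y z = begin
      (x ⊕ y) ⊕ z                        ≡⟨ mod-⊕ (toℕ x + toℕ y) z ⟩
      (toℕ x + toℕ y + toℕ z) mod m      ≡⟨ cong (_mod m) (+-assoc (toℕ x) (toℕ y) (toℕ z)) ⟩
      (toℕ x + (toℕ y + toℕ z)) mod m    ≡⟨ cong (_mod m) (+-comm (toℕ x) (toℕ y + toℕ z)) ⟩
      (toℕ y + toℕ z + toℕ x) mod m      ≡⟨ mod-⊕ (toℕ y + toℕ z) x ⟨
      (y ⊕ z) ⊕ x                        ≡⟨ ⊕-comm (y ⊕ z) x ⟩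
      x ⊕ (y ⊕ z)                        ∎
      where open ≡-Reasoning

    ⊕-identityˡ : ∀ x → (0 mod m) ⊕ x ≡ x
    ⊕-identityˡ x = trans (mod-⊕ 0 x) (mod-toℕ x)

    ⊕-inverseˡ : ∀ x → neg x ⊕ x ≡ 0 mod m
    ⊕-inverseˡ x = trans (mod-⊕ (m ∸ toℕ x) x) (mod-cong (begin
      (m ∸ toℕ x + toℕ x) % m  ≡⟨ cong (_% m) (+-comm (m ∸ toℕ x) (toℕ x)) ⟩
      (toℕ x + (m ∸ toℕ x)) % m  ≡⟨ cong (_% m) (m+[n∸m]≡n (<⇒≤ (toℕ<n x))) ⟩
      m % m                    ≡⟨ n%n≡0 m ⟩
      0                        ≡⟨ trans (sym (n%n≡0 m)) (trans (sym (m%n%n≡m%n m m)) (cong (_% m) (n%n≡0 m))) ⟩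
      0 % m                    ∎))
      where open ≡-Reasoning

  -- The cyclic group of order m: residues under addition modulo m.
  ℤ/ : Group 0ℓ 0ℓ
  ℤ/ = record
    { Carrier = Fin m
    ; _≈_     = _≡_
    ; _∙_     = _⊕_
    ; ε       = 0 mod m
    ; _⁻¹     = neg
    ; isGroup = record
      { isMonoid = record
        { isSemigroup = record
          { isMagma = record { isEquivalence = isEquivalence ; ∙-cong = cong₂ _⊕_ }
          ; assoc   = ⊕-assoc
          }
        ; identity = ⊕-identityˡ , λ x → trans (⊕-comm x (0 mod m)) (⊕-identityˡ x)
        }
      ; inverse = ⊕-inverseˡ , λ x → trans (⊕-comm x (neg x)) (⊕-inverseˡ x)
      ; ⁻¹-cong = cong neg
      }
    }

{-# OPTIONS --safe #-}

-- With D = d + 1, reserve a subset R of size 5D of A, in which subset sums of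
-- equal size are distinct and no nonempty subset sums to zero; a greedy choice
-- finds it once A is large.  Order A ∖ R greedily: a new partial sum must avoid
-- at most d earlier ones and the total sum, so this works until at most D
-- elements are left, and each of those is placed right after an element of R
-- that makes both new partial sums allowed.  At least 4D elements of R remain, say
-- m, and a union bound over their m! orderings finishes: edges inside this last
-- block hold automatically, and a forbidden value for the sum of the first j
-- elements is attained by at most one j-subset, hence by at most j!(m − j)!
-- orderings, where d Σ_{0<j<m} j!(m − j)! ≤ 4d (m − 1)! < m!.
module Submission where

open import Defs
open import Algebra.Bundles using (Group)
open import Data.Fin.Subset using (Subset; _∈_; _∉_; ∣_∣)
open import Data.Nat.Base using (ℕ; _≤_; _<_; _^_)
open import Data.Nat.Primality using (Prime; prime⇒nonZero)
open import Data.Product.Base using (∃)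
open import Relation.Binary.PropositionalEquality using (_≡_)
open import Algebra.Core using (Op₁; Op₂)
import Algebra.Properties.Group as GroupProperties
open import Algebra.Structures using (IsAbelianGroup)
open import Data.Bool.Base using (true; false; if_then_else_)
open import Data.Empty using (⊥)
open import Data.Fin.Base using (Fin; zero; suc; toℕ; fromℕ<)
import Data.Fin.Properties as Fin
open import Data.List.Base using (List; []; _∷_; _++_; [_]; map; length; foldl; take; lookup; tabulate; filter; allFin; cartesianProductWith)
open import Data.List.Properties using (length-map; length-++; ++-assoc; foldl-++; take-all)
open import Data.List.Membership.Propositional using (find) renaming (_∈_ to _∈ₗ_; _∉_ to _∉ₗ_)
import Data.List.Membership.DecPropositional as DecMembership
open import Data.List.Membership.Propositional.Properties using (∈-∃++; ∈-map⁺; ∈-map⁻; ∈-++⁺ˡ; ∈-++⁺ʳ; ∈-cartesianProductWith⁺; ∈-lookup; ∈-filter⁺; ∈-allFin)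
open import Data.List.Relation.Binary.Permutation.Propositional as ↭
  using (_↭_; refl; prep; swap; ↭-refl; ↭-reflexive; ↭-sym; ↭-trans; ↭⇒↭ₛ)
open import Data.List.Relation.Binary.Permutation.Propositional.Properties
  using (shift; ++-comm; ++⁺; ++⁺ˡ; ++⁺ʳ; ↭-length; ∈-resp-↭)
import Data.List.Relation.Binary.Permutation.Setoid.Properties as Permₛ
open import Data.List.Relation.Unary.All as All using (All; []; _∷_)
open import Data.List.Relation.Unary.All.Properties using (¬All⇒Any¬)
open import Data.List.Relation.Unary.Any using (here; there; index)
open import Data.List.Relation.Unary.Any.Properties using (lookup-index)
open import Data.List.Relation.Unary.AllPairs using ([]; _∷_)
open import Data.List.Relation.Unary.Unique.Propositional using (Unique)
import Data.List.Relation.Unary.Unique.Propositional.Properties as Unique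
open import Data.Nat.Base using (zero; suc; _+_; _*_; _⊔_; NonZero; _!; z≤n; s≤s; z<s)
open import Data.Nat.DivMod using (_mod_)
open import Data.Nat.ListAction using (sum)
open import Data.Nat.Properties hiding (_≟_)
open import Data.Nat.Solver using (module +-*-Solver)
open import Data.Product.Base using (∃₂; _×_; proj₂; _,_; map₂)
open import Data.Sum.Base using (inj₁; inj₂)
open import Data.Unit.Base using (⊤; tt)
import Data.Vec.Base as Vec
open import Data.Vec.Base using ([]; _∷_)
open import Data.Vec.Functional using (Vector; foldr)
open import Function.Base using (_∘_; id)
open import Function.Definitions using (Injective)
open import Level using (0ℓ)
open import Relation.Binary.Definitions using (DecidableEquality; tri<; tri≈; tri>)
open import Relation.Binary.PropositionalEquality
  using (_≢_; refl; sym; trans; cong; cong₂; subst; subst₂; setoid; module ≡-Reasoning)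
open import Relation.Nullary.Decidable using (Dec; yes; no; does; dec-true)
open import Relation.Nullary.Negation using (contradiction)
open import Relation.Unary as Unary using (Pred)

-- Finite sums over lists.

private variable
  A B : Set

∑ : List A → (A → ℕ) → ℕ
∑ xs φ = sum (map φ xs)

∑-cong : ∀ {φ ψ : A → ℕ} (xs : List A) → (∀ x → φ x ≡ ψ x) → ∑ xs φ ≡ ∑ xs ψ
∑-cong []       eq = refl
∑-cong (x ∷ xs) eq = cong₂ _+_ (eq x) (∑-cong xs eq)

∑-zero : (xs : List A) → ∑ xs (λ _ → 0) ≡ 0
∑-zero []       = refl
∑-zero (x ∷ xs) = ∑-zero xs

∑-+ : ∀ (φ ψ : A → ℕ) xs → ∑ xs (λ x → φ x + ψ x) ≡ ∑ xs φ + ∑ xs ψ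
∑-+ φ ψ []       = refl
∑-+ φ ψ (x ∷ xs) = trans (cong (φ x + ψ x +_) (∑-+ φ ψ xs))
  (solve 4 (λ a b c e → (a :+ b) :+ (c :+ e) := (a :+ c) :+ (b :+ e)) refl (φ x) (ψ x) (∑ xs φ) (∑ xs ψ))
  where open +-*-Solver

∑-*ˡ : ∀ k (φ : A → ℕ) xs → ∑ xs (λ x → k * φ x) ≡ k * ∑ xs φ
∑-*ˡ k φ []       = sym (*-zeroʳ k)
∑-*ˡ k φ (x ∷ xs) = trans (cong (k * φ x +_) (∑-*ˡ k φ xs)) (sym (*-distribˡ-+ k (φ x) (∑ xs φ)))

∑-*ʳ : ∀ k (φ : A → ℕ) xs → ∑ xs (λ x → φ x * k) ≡ ∑ xs φ * k
∑-*ʳ k φ []       = refl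
∑-*ʳ k φ (x ∷ xs) = trans (cong (φ x * k +_) (∑-*ʳ k φ xs)) (sym (*-distribʳ-+ k (φ x) (∑ xs φ)))

∑-comm : ∀ (φ : A → B → ℕ) xs ys → ∑ xs (λ x → ∑ ys (φ x)) ≡ ∑ ys (λ y → ∑ xs (λ x → φ x y))
∑-comm φ []       ys = sym (∑-zero ys)
∑-comm φ (x ∷ xs) ys = trans (cong (∑ ys (φ x) +_) (∑-comm φ xs ys))
  (sym (∑-+ (φ x) (λ y → ∑ xs (λ x′ → φ x′ y)) ys))

∑-map : ∀ (φ : B → ℕ) (g : A → B) xs → ∑ (map g xs) φ ≡ ∑ xs (λ x → φ (g x))
∑-map φ g []       = refl
∑-map φ g (x ∷ xs) = cong (φ (g x) +_) (∑-map φ g xs)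

∑-≤-length : ∀ (φ : A → ℕ) xs → (∀ x → φ x ≤ 1) → ∑ xs φ ≤ length xs
∑-≤-length φ []       φ≤1 = z≤n
∑-≤-length φ (x ∷ xs) φ≤1 = +-mono-≤ (φ≤1 x) (∑-≤-length φ xs φ≤1)

∈⇒≤∑ : ∀ (φ : A → ℕ) {x xs} → x ∈ₗ xs → φ x ≤ ∑ xs φ
∈⇒≤∑ φ (here refl)          = m≤m+n _ _
∈⇒≤∑ φ (there {x = y} x∈xs) = ≤-trans (∈⇒≤∑ φ x∈xs) (m≤n+m _ (φ y))

∑-below-average : ∀ (φ : A → ℕ) b xs → ∑ xs φ < length xs * b → ∃ λ x → x ∈ₗ xs × φ x < b
∑-below-average φ b (x ∷ xs) lt with φ x <? b
... | yes φx<b = x , here refl , φx<b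
... | no  φx≮b
  with y , y∈xs , φy<b ← ∑-below-average φ b xs
         (+-cancelˡ-< b _ _ (≤-<-trans (+-monoˡ-≤ (∑ xs φ) (≮⇒≥ φx≮b)) lt))
  = y , there y∈xs , φy<b

-- Estimate for the sum of the products j!(m - j)!.

-- This is Σ_{i<r} (j + i)!(r - i)!. For j = 1 and m = r + 1 it is the sum of i!(m - i)! over 0 < i
-- < m from the union bound.
factorialSum : ℕ → ℕ → ℕ
factorialSum j zero    = 0
factorialSum j (suc r) = j ! * suc r ! + factorialSum (suc j) r

-- Equality holds at a = 0. Raising `a` by one multiplies the left side by 3 + a and the right side
-- by 3 + a + b.
[2+a]!*[2+b]!≤2*[2+a+b]! : ∀ a b → (2 + a) ! * (2 + b) ! ≤ 2 * (2 + (a + b)) !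
[2+a]!*[2+b]!≤2*[2+a+b]! zero    b = ≤-refl
[2+a]!*[2+b]!≤2*[2+a+b]! (suc a) b = begin
  (3 + a) * (2 + a) ! * (2 + b) !            ≡⟨ *-assoc (3 + a) ((2 + a) !) ((2 + b) !) ⟩
  (3 + a) * ((2 + a) ! * (2 + b) !)          ≤⟨ *-mono-≤ (m≤m+n (3 + a) b) ([2+a]!*[2+b]!≤2*[2+a+b]! a b) ⟩
  (3 + (a + b)) * (2 * (2 + (a + b)) !)      ≡⟨ solve 2 (λ x y → x :* (con 2 :* y) := con 2 :* (x :* y)) refl (3 + (a + b)) ((2 + (a + b)) !) ⟩
  2 * (3 + (a + b)) !                        ∎
  where
  open ≤-Reasoning
  open +-*-Solver

-- The last term is (1 + (a + r))! times 1!. In every other term both factors are factorials of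
-- numbers at least 2 with sum 2 + (a + r), so the preceding lemma bounds it by 2(a + r)!.
factorialSum-tail : ∀ a r → factorialSum (2 + a) r ≤ r * (2 * (a + r) !) + (1 + (a + r)) !
factorialSum-tail a zero          = z≤n
factorialSum-tail a (suc zero)    = begin
  (2 + a) ! * 1 + 0                               ≡⟨ trans (+-identityʳ _) (*-identityʳ _) ⟩
  (2 + a) !                                       ≡⟨ cong (λ t → suc t !) (+-comm 1 a) ⟩
  (1 + (a + 1)) !                                 ≤⟨ m≤n+m _ (1 * (2 * (a + 1) !)) ⟩
  1 * (2 * (a + 1) !) + (1 + (a + 1)) !           ∎
  where open ≤-Reasoning
factorialSum-tail a (suc (suc b)) = begin
  (2 + a) ! * (2 + b) ! + factorialSum (3 + a) (1 + b)
    ≤⟨ +-mono-≤ ([2+a]!*[2+b]!≤2*[2+a+b]! a b) (factorialSum-tail (suc a) (suc b)) ⟩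
  2 * (2 + (a + b)) ! + ((1 + b) * (2 * (1 + (a + (1 + b))) !) + (2 + (a + (1 + b))) !)
    ≡⟨ +-assoc (2 * (2 + (a + b)) !) _ _ ⟨
  2 * (2 + (a + b)) ! + (1 + b) * (2 * (1 + (a + (1 + b))) !) + (2 + (a + (1 + b))) !
    ≡⟨ cong₂ (λ t u → 2 * t ! + (1 + b) * (2 * u !) + (1 + u) !)
         (trans (cong suc (sym (+-suc a b))) (sym (+-suc a (suc b)))) (sym (+-suc a (suc b))) ⟩
  (2 + b) * (2 * (a + (2 + b)) !) + (1 + (a + (2 + b))) ! ∎
  where open ≤-Reasoning

-- The first and the last term are r! each, and the fewer than r terms between them are at most 2(r
-- - 1)! each.
factorialSum-≤ : ∀ r → factorialSum 1 r ≤ 4 * r !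
factorialSum-≤ zero    = z≤n
factorialSum-≤ (suc b) = begin
  1 * suc b ! + factorialSum 2 b               ≤⟨ +-monoʳ-≤ (1 * suc b !) (factorialSum-tail 0 b) ⟩
  1 * suc b ! + (b * (2 * b !) + suc b !)      ≤⟨ +-monoʳ-≤ (1 * suc b !) (+-monoˡ-≤ (suc b !) (*-monoˡ-≤ (2 * b !) (n≤1+n b))) ⟩
  1 * suc b ! + (suc b * (2 * b !) + suc b !)  ≡⟨ solve 2 (λ x y → con 1 :* (x :* y) :+ (x :* (con 2 :* y) :+ x :* y) := con 4 :* (x :* y)) refl (suc b) (b !) ⟩
  4 * suc b !                                  ∎
  where
  open ≤-Reasoning
  open +-*-Solver

-- Permutations of duplicate-free lists and choosing elements from them.

module _ {A : Set} where

  ∈⇒↭∷ : ∀ {x : A} {xs} → x ∈ₗ xs → ∃ λ xs′ → xs ↭ x ∷ xs′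
  ∈⇒↭∷ {x} x∈xs with ys , zs , refl ← ∈-∃++ x∈xs = ys ++ zs , shift x ys zs

  Unique-resp-↭ : ∀ {xs ys : List A} → xs ↭ ys → Unique xs → Unique ys
  Unique-resp-↭ xs↭ys = Permₛ.Unique-resp-↭ (setoid A) (↭⇒↭ₛ xs↭ys)

  Unique-++ʳ : ∀ (xs : List A) {ys} → Unique (xs ++ ys) → Unique ys
  Unique-++ʳ []       u       = u
  Unique-++ʳ (x ∷ xs) (_ ∷ u) = Unique-++ʳ xs u

  Unique-++ˡ : ∀ (xs : List A) {ys} → Unique (xs ++ ys) → Unique xs
  Unique-++ˡ xs {ys} u = Unique-++ʳ ys (Unique-resp-↭ (++-comm xs ys) u)

  Unique-⊆⇒length≤ : ∀ {xs ys : List A} → Unique xs → (∀ {x} → x ∈ₗ xs → x ∈ₗ ys) → length xs ≤ length ys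
  Unique-⊆⇒length≤ {[]}     []         _     = z≤n
  Unique-⊆⇒length≤ {x ∷ xs} (x∉xs ∷ u) xs⊆ys
    with ys′ , ys↭ ← ∈⇒↭∷ (xs⊆ys (here refl))
    = subst (suc (length xs) ≤_) (sym (↭-length ys↭)) (s≤s (Unique-⊆⇒length≤ u λ y∈xs →
        drop-head (All.lookup x∉xs y∈xs) (∈-resp-↭ ys↭ (xs⊆ys (there y∈xs)))))
    where
    drop-head : ∀ {y zs} → x ≢ y → y ∈ₗ x ∷ zs → y ∈ₗ zs
    drop-head x≢y (here y≡x) = contradiction (sym y≡x) x≢y
    drop-head x≢y (there y∈) = y∈

  module _ (_≟_ : DecidableEquality A) where
    open DecMembership _≟_ using (_∈?_)

    -- Every greedy choice below goes through this pigeonhole step: if all of `xs` lay in `ys`, then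
    -- `ys` would be at least as long.
    pick-avoiding : ∀ {xs ys : List A} → Unique xs → length ys < length xs →
                    ∃₂ λ x xs′ → xs ↭ x ∷ xs′ × x ∉ₗ ys
    pick-avoiding {xs} {ys} u ys<xs with All.all? (_∈? ys) xs
    ... | yes xs⊆ys = contradiction (Unique-⊆⇒length≤ u (All.lookup xs⊆ys)) (<⇒≱ ys<xs)
    ... | no  xs⊈ys with x , x∈xs , x∉ys ← find (¬All⇒Any¬ (_∈? ys) xs xs⊈ys)
                    with xs′ , xs↭ ← ∈⇒↭∷ x∈xs
                    = x , xs′ , xs↭ , x∉ys

  -- Possible first terms of an ordering, each with what is then left to order; an average over the
  -- first term is a sum over this list.
  picks : List A → List (A × List A)
  picks []       = []
  picks (x ∷ xs) = (x , xs) ∷ map (map₂ (x ∷_)) (picks xs)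

  length-picks : ∀ xs → length (picks xs) ≡ length xs
  length-picks []       = refl
  length-picks (x ∷ xs) = cong suc (trans (length-map _ (picks xs)) (length-picks xs))

  picks-↭ : ∀ xs {y ys} → (y , ys) ∈ₗ picks xs → xs ↭ y ∷ ys
  picks-↭ (x ∷ xs) (here refl) = ↭-refl
  picks-↭ (x ∷ xs) (there p)
    with _ , p′ , refl ← ∈-map⁻ (map₂ (x ∷_)) p
    = ↭-trans (prep x (picks-↭ xs p′)) (swap x _ ↭-refl)

length-cartesianProductWith : ∀ {A B C : Set} (f : A → B → C) xs ys →
                              length (cartesianProductWith f xs ys) ≡ length xs * length ys
length-cartesianProductWith f []       ys = refl
length-cartesianProductWith f (x ∷ xs) ys =
  trans (length-++ (map (f x) ys)) (cong₂ _+_ (length-map (f x) ys) (length-cartesianProductWith f xs ys))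

-- Sums in an abelian group, counting sublists by sum, and the union bound over orderings.

module Sequencing {A : Set} {_∙_ : Op₂ A} {ε : A} {_⁻¹ : Op₁ A}
  (isAbelianGroup : IsAbelianGroup _≡_ _∙_ ε _⁻¹) (_≟_ : DecidableEquality A) where

  open IsAbelianGroup isAbelianGroup using (isGroup; assoc; comm; identityʳ)

  private
    group : Group 0ℓ 0ℓ
    group = record { isGroup = isGroup }

  open GroupProperties group using (∙-cancelˡ; \\-leftDividesʳ; //-rightDividesʳ)

  right-comm : ∀ x y z → (x ∙ y) ∙ z ≡ (x ∙ z) ∙ y
  right-comm x y z = trans (assoc x y z) (trans (cong (x ∙_) (comm y z)) (sym (assoc x z y)))

  x∙y≡x⇒y≡ε : ∀ {x y} → x ∙ y ≡ x → y ≡ ε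
  x∙y≡x⇒y≡ε {x} {y} eq = ∙-cancelˡ x y ε (trans eq (sym (identityʳ x)))

  -- An arbitrary starting point lets a sum be continued: splitting off a leading term only moves
  -- the start.
  end : A → List A → A
  end = foldl _∙_

  end-↭ : ∀ s {xs ys} → xs ↭ ys → end s xs ≡ end s ys
  end-↭ s refl           = refl
  end-↭ s (prep x p)     = end-↭ (s ∙ x) p
  end-↭ s (swap {xs = xs} x y p) = trans (cong (λ t → end t xs) (right-comm s x y)) (end-↭ ((s ∙ y) ∙ x) p)
  end-↭ s (↭.trans p q)  = trans (end-↭ s p) (end-↭ s q)

  -- The number of sublists of M of length j whose sum leads from s to f.
  hits : ℕ → List A → A → A → ℕ
  hits zero    M       s f = if does (s ≟ f) then 1 else 0
  hits (suc j) []      s f = 0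
  hits (suc j) (x ∷ M) s f = hits (suc j) M s f + hits j M (s ∙ x) f

  hits-zero-≤1 : ∀ M s f → hits 0 M s f ≤ 1
  hits-zero-≤1 M s f with does (s ≟ f)
  ... | true  = ≤-refl
  ... | false = z≤n

  hits-zero-refl : ∀ M s → hits 0 M s s ≡ 1
  hits-zero-refl M s rewrite dec-true (s ≟ s) refl = refl

  hits-↭ : ∀ j {M M′} s f → M ↭ M′ → hits j M s f ≡ hits j M′ s f
  hits-↭ zero          s f p          = refl
  hits-↭ (suc j)       s f refl       = refl
  hits-↭ (suc j)       s f (prep x p) = cong₂ _+_ (hits-↭ (suc j) s f p) (hits-↭ j (s ∙ x) f p)
  hits-↭ (suc zero)    {_ ∷ _ ∷ M} {_ ∷ _ ∷ M′} s f (swap x y p) =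
    trans (+-assoc (hits 1 M s f) _ _) (trans (cong₂ _+_ (hits-↭ 1 s f p) (+-comm (hits 0 M (s ∙ y) f) _))
      (sym (+-assoc (hits 1 M′ s f) _ _)))
  -- The four summands belong to sublists with neither of x and y, only y, only x, or both. The swap
  -- exchanges the middle two.
  hits-↭ (suc (suc j)) {_ ∷ _ ∷ M} {_ ∷ _ ∷ M′} s f (swap x y p) = begin
    (a M s + b M (s ∙ y)) + (b M (s ∙ x) + c M ((s ∙ x) ∙ y))
      ≡⟨ cong₂ _+_ (cong₂ _+_ (hits-↭ (2 + j) s f p) (hits-↭ (1 + j) (s ∙ y) f p))
                   (cong₂ _+_ (hits-↭ (1 + j) (s ∙ x) f p)
                     (trans (cong (c M) (right-comm s x y)) (hits-↭ j ((s ∙ y) ∙ x) f p))) ⟩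
    (a M′ s + b M′ (s ∙ y)) + (b M′ (s ∙ x) + c M′ ((s ∙ y) ∙ x))
      ≡⟨ solve 4 (λ p q r t → (p :+ q) :+ (r :+ t) := (p :+ r) :+ (q :+ t)) refl
           (a M′ s) (b M′ (s ∙ y)) (b M′ (s ∙ x)) (c M′ ((s ∙ y) ∙ x)) ⟩
    (a M′ s + b M′ (s ∙ x)) + (b M′ (s ∙ y) + c M′ ((s ∙ y) ∙ x)) ∎
    where
    open ≡-Reasoning
    open +-*-Solver
    a b c : List A → A → ℕ
    a N t = hits (2 + j) N t f
    b N t = hits (1 + j) N t f
    c N t = hits j N t f
  hits-↭ (suc j) s f (↭.trans p q) = trans (hits-↭ (suc j) s f p) (hits-↭ (suc j) s f q)

  hits-≤-∷ : ∀ j x M s f → hits j M s f ≤ hits j (x ∷ M) s f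
  hits-≤-∷ zero    x M s f = ≤-refl
  hits-≤-∷ (suc j) x M s f = m≤m+n _ _

  -- Every sublist of length suc j is counted once for each choice of its first element.
  hits-picks : ∀ j M s f → ∑ (picks M) (λ (x , M′) → hits j M′ (s ∙ x) f) ≡ suc j * hits (suc j) M s f
  hits-picks j       []      s f = sym (*-zeroʳ j)
  hits-picks zero    (x ∷ M) s f = begin
    hits 0 M (s ∙ x) f + ∑ (map (map₂ (x ∷_)) (picks M)) (λ (y , M′) → hits 0 M′ (s ∙ y) f)
      ≡⟨ cong (hits 0 M (s ∙ x) f +_) (trans (∑-map _ (map₂ (x ∷_)) (picks M)) (hits-picks zero M s f)) ⟩
    hits 0 M (s ∙ x) f + 1 * hits 1 M s f
      ≡⟨ solve 2 (λ p q → p :+ con 1 :* q := con 1 :* (q :+ p)) refl (hits 0 M (s ∙ x) f) (hits 1 M s f) ⟩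
    1 * (hits 1 M s f + hits 0 M (s ∙ x) f) ∎
    where
    open ≡-Reasoning
    open +-*-Solver
  hits-picks (suc i) (x ∷ M) s f = begin
    hits (suc i) M (s ∙ x) f + ∑ (map (map₂ (x ∷_)) (picks M)) (λ (y , M′) → hits (suc i) M′ (s ∙ y) f)
      ≡⟨ cong (hits (suc i) M (s ∙ x) f +_) (∑-map _ (map₂ (x ∷_)) (picks M)) ⟩
    hits (suc i) M (s ∙ x) f + ∑ (picks M) (λ (y , M′) → hits (suc i) M′ (s ∙ y) f + hits i M′ ((s ∙ y) ∙ x) f)
      ≡⟨ cong (hits (suc i) M (s ∙ x) f +_) (trans
           (∑-cong (picks M) λ (y , M′) → cong (λ t → hits (suc i) M′ (s ∙ y) f + hits i M′ t f) (right-comm s y x))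
           (∑-+ _ _ (picks M))) ⟩
    hits (suc i) M (s ∙ x) f + (∑ (picks M) (λ (y , M′) → hits (suc i) M′ (s ∙ y) f)
                              + ∑ (picks M) (λ (y , M′) → hits i M′ ((s ∙ x) ∙ y) f))
      ≡⟨ cong (hits (suc i) M (s ∙ x) f +_) (cong₂ _+_ (hits-picks (suc i) M s f) (hits-picks i M (s ∙ x) f)) ⟩
    hits (suc i) M (s ∙ x) f + ((2 + i) * hits (2 + i) M s f + suc i * hits (suc i) M (s ∙ x) f)
      ≡⟨ solve 3 (λ p q k → p :+ ((con 1 :+ k) :* q :+ k :* p) := (con 1 :+ k) :* (q :+ p)) refl
           (hits (suc i) M (s ∙ x) f) (hits (2 + i) M s f) (suc i) ⟩
    (2 + i) * (hits (2 + i) M s f + hits (suc i) M (s ∙ x) f) ∎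
    where
    open ≡-Reasoning
    open +-*-Solver

  -- When length Fs + j = length M, this counts the triples of an ordering of M,
  -- an index i and an element f of the i-th list of Fs (counting from 0) such
  -- that the first j + i terms lead from s to f.
  violations : ℕ → List A → A → List (List A) → ℕ
  violations j M s []       = 0
  violations j M s (F ∷ Fs) = ∑ F (hits j M s) * (j ! * suc (length Fs) !) + violations (suc j) M s Fs

  -- `hits-picks` produces a factor suc j, which turns the weight j! into (suc j)!, so summing over
  -- all first terms merely raises the index.
  violations-picks : ∀ j M s Fs → ∑ (picks M) (λ (x , M′) → violations j M′ (s ∙ x) Fs) ≡ violations (suc j) M s Fs
  violations-picks j M s []       = ∑-zero (picks M)
  violations-picks j M s (F ∷ Fs) = begin
    ∑ (picks M) (λ (x , M′) → ∑ F (hits j M′ (s ∙ x)) * w + violations (suc j) M′ (s ∙ x) Fs)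
      ≡⟨ ∑-+ _ _ (picks M) ⟩
    ∑ (picks M) (λ (x , M′) → ∑ F (hits j M′ (s ∙ x)) * w) + ∑ (picks M) (λ (x , M′) → violations (suc j) M′ (s ∙ x) Fs)
      ≡⟨ cong₂ _+_ (∑-*ʳ w _ (picks M)) (violations-picks (suc j) M s Fs) ⟩
    ∑ (picks M) (λ (x , M′) → ∑ F (hits j M′ (s ∙ x))) * w + violations (2 + j) M s Fs
      ≡⟨ cong (λ t → t * w + violations (2 + j) M s Fs) (begin
           ∑ (picks M) (λ (x , M′) → ∑ F (hits j M′ (s ∙ x)))
             ≡⟨ ∑-comm (λ (x , M′) → hits j M′ (s ∙ x)) (picks M) F ⟩
           ∑ F (λ f → ∑ (picks M) (λ (x , M′) → hits j M′ (s ∙ x) f))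
             ≡⟨ ∑-cong F (hits-picks j M s) ⟩
           ∑ F (λ f → suc j * hits (suc j) M s f)
             ≡⟨ ∑-*ˡ (suc j) _ F ⟩
           suc j * ∑ F (hits (suc j) M s) ∎) ⟩
    suc j * ∑ F (hits (suc j) M s) * (j ! * suc (length Fs) !) + violations (2 + j) M s Fs
      ≡⟨ cong (_+ violations (2 + j) M s Fs)
           (solve 4 (λ k h p q → k :* h :* (p :* q) := h :* (k :* p :* q)) refl
             (suc j) (∑ F (hits (suc j) M s)) (j !) (suc (length Fs) !)) ⟩
    violations (suc j) M s (F ∷ Fs) ∎
    where
    open ≡-Reasoning
    open +-*-Solver
    w = j ! * suc (length Fs) !

  -- Terms left over when `Fs` is used up are free. In an ordering with one term more than `Fs` has
  -- lists, this frees the full sum, which is the same for all orderings.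
  Avoids : A → List A → List (List A) → Set
  Avoids s l       []       = ⊤
  Avoids s []      (F ∷ Fs) = ⊥
  Avoids s (x ∷ l) (F ∷ Fs) = (s ∙ x) ∉ₗ F × Avoids (s ∙ x) l Fs

  -- The average of the number of violations over the first element does not
  -- change, so some first element keeps it below the number of orderings.
  avoiding-ordering : ∀ Fs M s → length M ≡ suc (length Fs) → violations 1 M s Fs < length M ! →
                      ∃ λ l → l ↭ M × Avoids s l Fs
  avoiding-ordering []       M s eq few = M , ↭-refl , tt
  avoiding-ordering (F ∷ Fs) M s eq few
    -- The index is 0 because x is already placed: the summand of `F` tests `s ∙ x` itself, and the
    -- rest is the count for the orderings of `M′` to come. The threshold (length M - 1)! is the
    -- number of these orderings.
    with (x , M′) , x∈ , few′ ← ∑-below-average (λ (x , M′) → violations 0 M′ (s ∙ x) (F ∷ Fs)) (suc (length Fs) !) (picks M)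
           (subst₂ _<_ (sym (violations-picks 0 M s (F ∷ Fs)))
             (trans (cong _! eq) (cong (_* suc (length Fs) !) (sym (trans (length-picks M) eq)))) few)
    with M↭ ← picks-↭ M x∈
    with eq′ ← suc-injective (trans (sym (↭-length M↭)) eq)
    with l , l↭ , avoids ← avoiding-ordering Fs M′ (s ∙ x) eq′
           (subst (λ n → violations 1 M′ (s ∙ x) Fs < n !) (sym eq′) (≤-<-trans (m≤n+m _ _) few′))
    = x ∷ l , ↭-trans (prep x l↭) (↭-sym M↭) , s∙x∉F , avoids
    where
    open ≤-Reasoning
    -- If `s ∙ x` were in `F`, every ordering of `M′` would count as a violation, already too many.
    s∙x∉F : (s ∙ x) ∉ₗ F
    s∙x∉F s∙x∈F = <⇒≱ few′ (begin
      suc (length Fs) !                                             ≡⟨ trans (*-identityˡ _) (*-identityˡ _) ⟨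
      1 * (1 * suc (length Fs) !)                                   ≡⟨ cong (_* (1 * suc (length Fs) !)) (hits-zero-refl M′ (s ∙ x)) ⟨
      hits 0 M′ (s ∙ x) (s ∙ x) * (1 * suc (length Fs) !)           ≤⟨ *-monoˡ-≤ (1 * suc (length Fs) !) (∈⇒≤∑ (hits 0 M′ (s ∙ x)) s∙x∈F) ⟩
      ∑ F (hits 0 M′ (s ∙ x)) * (1 * suc (length Fs) !)             ≤⟨ m≤m+n _ _ ⟩
      violations 0 M′ (s ∙ x) (F ∷ Fs)                              ∎)

  -- Generic lists and their greedy construction.

  record Generic (R : List A) : Set where
    field
      hits≤1  : ∀ j s f → hits j R s f ≤ 1
      no-loop : ∀ j s → hits (suc j) R s s ≡ 0

  open Generic

  Generic-resp-↭ : ∀ {R R′} → R ↭ R′ → Generic R → Generic R′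
  Generic-resp-↭ R↭R′ g = record
    { hits≤1  = λ j s f → subst (_≤ 1) (hits-↭ j s f R↭R′) (g .hits≤1 j s f)
    ; no-loop = λ j s → trans (sym (hits-↭ (suc j) s s R↭R′)) (g .no-loop j s)
    }

  Generic-tail : ∀ {x R} → Generic (x ∷ R) → Generic R
  Generic-tail {x} {R} g = record
    { hits≤1  = λ j s f → ≤-trans (hits-≤-∷ j x R s f) (g .hits≤1 j s f)
    ; no-loop = λ j s → n≤0⇒n≡0 (≤-trans (hits-≤-∷ (suc j) x R s s) (≤-reflexive (g .no-loop j s)))
    }

  subsetSums : List A → List A
  subsetSums []      = [ ε ]
  subsetSums (x ∷ M) = subsetSums M ++ map (x ∙_) (subsetSums M)

  length-subsetSums : ∀ M → length (subsetSums M) ≡ 2 ^ length M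
  length-subsetSums []      = refl
  length-subsetSums (x ∷ M) = trans (length-++ (subsetSums M)) (cong₂ _+_ (length-subsetSums M)
    (trans (length-map (x ∙_) (subsetSums M)) (trans (length-subsetSums M) (sym (+-identityʳ _)))))

  ε∈subsetSums : ∀ M → ε ∈ₗ subsetSums M
  ε∈subsetSums []      = here refl
  ε∈subsetSums (x ∷ M) = ∈-++⁺ˡ (ε∈subsetSums M)

  hits>0⇒∈subsetSums : ∀ j M s f → 0 < hits j M s f → ∃ λ u → u ∈ₗ subsetSums M × s ∙ u ≡ f
  hits>0⇒∈subsetSums zero M s f h with s ≟ f
  ... | yes s≡f = ε , ε∈subsetSums M , trans (identityʳ s) s≡f
  ... | no  _   = contradiction h (<-irrefl refl)
  hits>0⇒∈subsetSums (suc j) (x ∷ M) s f h with 0 <? hits (suc j) M s f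
  ... | yes h₁ with u , u∈ , eq ← hits>0⇒∈subsetSums (suc j) M s f h₁ = u , ∈-++⁺ˡ u∈ , eq
  ... | no  h₁ with u , u∈ , eq ← hits>0⇒∈subsetSums j M (s ∙ x) f
                      (subst (λ t → 0 < t + hits j M (s ∙ x) f) (n≤0⇒n≡0 (≮⇒≥ h₁)) h)
      = x ∙ u , ∈-++⁺ʳ (subsetSums M) (∈-map⁺ (x ∙_) u∈) , trans (sym (assoc s x u)) eq

  differences : List A → List A
  differences M = cartesianProductWith (λ u v → u ∙ (v ⁻¹)) (subsetSums M) (subsetSums M)

  length-differences : ∀ M → length (differences M) ≡ 2 ^ length M * 2 ^ length M
  length-differences M = trans (length-cartesianProductWith _ (subsetSums M) (subsetSums M))
    (cong₂ _*_ (length-subsetSums M) (length-subsetSums M))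

  ∈differences : ∀ {M u v s x} → u ∈ₗ subsetSums M → v ∈ₗ subsetSums M → s ∙ u ≡ (s ∙ x) ∙ v → x ∈ₗ differences M
  ∈differences {M} {u} {v} {s} {x} u∈ v∈ eq = subst (_∈ₗ differences M)
    (trans (cong (_∙ (v ⁻¹)) (∙-cancelˡ s u (x ∙ v) (trans eq (assoc s x v)))) (//-rightDividesʳ v x))
    (∈-cartesianProductWith⁺ _ u∈ v∈)

  Generic-[] : Generic []
  Generic-[] = record
    { hits≤1  = λ { zero s f → hits-zero-≤1 [] s f ; (suc j) s f → z≤n }
    ; no-loop = λ j s → refl
    }

  -- Two sublists that both contain x, or both miss it, are covered by the genericity of `M`. If
  -- exactly one contains x, equal sums make x a difference of two subset sums of `M`; for a loop,
  -- one of the two is the empty sum.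
  Generic-∷ : ∀ {x M} → x ∉ₗ differences M → Generic M → Generic (x ∷ M)
  Generic-∷ {x} {M} x∉ g = record { hits≤1 = hits≤1-∷ ; no-loop = no-loop-∷ }
    where
    hits≤1-∷ : ∀ j s f → hits j (x ∷ M) s f ≤ 1
    hits≤1-∷ zero    s f = hits-zero-≤1 (x ∷ M) s f
    hits≤1-∷ (suc j) s f with 0 <? hits (suc j) M s f | 0 <? hits j M (s ∙ x) f
    ... | no  h₁ | _ = subst (λ t → t + hits j M (s ∙ x) f ≤ 1) (sym (n≤0⇒n≡0 (≮⇒≥ h₁))) (g .hits≤1 j (s ∙ x) f)
    ... | yes _  | no h₂ = subst (_≤ 1) (trans (sym (+-identityʳ _))
            (cong (hits (suc j) M s f +_) (sym (n≤0⇒n≡0 (≮⇒≥ h₂))))) (g .hits≤1 (suc j) s f)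
    ... | yes h₁ | yes h₂
      with _ , u∈ , eq₁ ← hits>0⇒∈subsetSums (suc j) M s f h₁
         | _ , v∈ , eq₂ ← hits>0⇒∈subsetSums j M (s ∙ x) f h₂
      = contradiction (∈differences {M} u∈ v∈ (trans eq₁ (sym eq₂))) x∉

    no-loop-∷ : ∀ j s → hits (suc j) (x ∷ M) s s ≡ 0
    no-loop-∷ j s with 0 <? hits j M (s ∙ x) s
    ... | no  h = cong₂ _+_ (g .no-loop j s) (n≤0⇒n≡0 (≮⇒≥ h))
    ... | yes h with _ , v∈ , eq ← hits>0⇒∈subsetSums j M (s ∙ x) s h
      = contradiction (∈differences {M} (ε∈subsetSums M) v∈ (trans (identityʳ s) (sym eq))) x∉

  -- A reserve of k elements rules out at most 2^k * 2^k values. Whenever a further element is asked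
  -- for, more elements than that are left in `B`, so the reserve grows greedily.
  generic-sublist : ∀ k {L} → Unique L → k + 2 ^ k * 2 ^ k ≤ length L →
                    ∃₂ λ R B → L ↭ R ++ B × length R ≡ k × Generic R
  generic-sublist zero    {L} u k≤ = [] , L , ↭-refl , refl , Generic-[]
  generic-sublist (suc k) {L} u k≤
    with R , B , L↭ , |R|≡k , g ← generic-sublist k u
           (≤-trans (+-mono-≤ (n≤1+n k) (*-mono-≤ (m≤m+n (2 ^ k) _) (m≤m+n (2 ^ k) _))) k≤)
    with x , B′ , B↭ , x∉ ← pick-avoiding _≟_ {B} {differences R} (Unique-++ʳ R (Unique-resp-↭ L↭ u))
           (+-cancelˡ-≤ k _ _ (≤-trans (≤-trans (≤-reflexive (trans
             (cong (λ t → k + suc t) (trans (length-differences R) (cong (λ t → 2 ^ t * 2 ^ t) |R|≡k))) (+-suc k _)))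
             (+-monoʳ-≤ (suc k) (*-mono-≤ (m≤m+n (2 ^ k) _) (m≤m+n (2 ^ k) _))))
             (≤-trans k≤ (≤-reflexive (trans (↭-length L↭) (trans (length-++ R) (cong (_+ length B) |R|≡k)))))))
    = x ∷ R , B′ , ↭-trans L↭ (↭-trans (++⁺ˡ R B↭) (shift x R B′)) , cong suc |R|≡k , Generic-∷ x∉ g

  -- Sums of prefixes.

  end-take-++ˡ : ∀ s l r {i} → i ≤ length l → end s (take i (l ++ r)) ≡ end s (take i l)
  end-take-++ˡ s l       r {zero}  _         = refl
  end-take-++ˡ s (x ∷ l) r {suc i} (s≤s i≤l) = end-take-++ˡ (s ∙ x) l r i≤l

  end-take-++ʳ : ∀ s l r i → end s (take (length l + i) (l ++ r)) ≡ end (end s l) (take i r)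
  end-take-++ʳ s []      r i = refl
  end-take-++ʳ s (x ∷ l) r i = end-take-++ʳ (s ∙ x) l r i

  hits-take : ∀ j r s → j ≤ length r → 0 < hits j r s (end s (take j r))
  hits-take zero    r       s _         = ≤-reflexive (sym (hits-zero-refl r s))
  hits-take (suc j) (x ∷ r) s (s≤s j≤r) = ≤-trans (hits-take j r (s ∙ x) j≤r) (m≤n+m _ _)

  -- Settles the edges inside the last block: once the first i common terms are dropped, equal ends
  -- would make a nonempty prefix a loop.
  Generic⇒end-take-≢ : ∀ {r} → Generic r → ∀ s {i j} → i < j → j ≤ length r → end s (take i r) ≢ end s (take j r)
  Generic⇒end-take-≢ {r} g s {zero} {suc j} i<j j≤r eq =
    <⇒≢ (hits-take (suc j) r s j≤r) (sym (trans (cong (hits (suc j) r s) (sym eq)) (g .no-loop j s)))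
  Generic⇒end-take-≢ {x ∷ r} g s {suc i} (s≤s i<j) (s≤s j≤r) = Generic⇒end-take-≢ (Generic-tail g) (s ∙ x) i<j j≤r

  violations-≤ : ∀ {R d} → Generic R → ∀ j s Fs → All (λ F → length F ≤ d) Fs →
                 violations j R s Fs ≤ d * factorialSum j (length Fs)
  violations-≤ {R} {d} g j s []       []         = z≤n
  violations-≤ {R} {d} g j s (F ∷ Fs) (F≤d ∷ Fs≤d) = begin
    ∑ F (hits j R s) * w + violations (suc j) R s Fs
      ≤⟨ +-mono-≤ (*-monoˡ-≤ w (≤-trans (∑-≤-length _ F (g .hits≤1 j s)) F≤d)) (violations-≤ g (suc j) s Fs Fs≤d) ⟩
    d * w + d * factorialSum (suc j) (length Fs)
      ≡⟨ *-distribˡ-+ d w _ ⟨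
    d * factorialSum j (suc (length Fs)) ∎
    where
    open ≤-Reasoning
    w = j ! * suc (length Fs) !

  generic-avoiding-ordering : ∀ {R d} → Generic R → ∀ s Fs → length R ≡ suc (length Fs) → d * 4 < length R →
                              All (λ F → length F ≤ d) Fs → ∃ λ r → r ↭ R × Avoids s r Fs
  generic-avoiding-ordering {R} {d} g s Fs |R|≡ 4d<|R| Fs≤d = avoiding-ordering Fs R s |R|≡ (begin-strict
    violations 1 R s Fs                 ≤⟨ violations-≤ g 1 s Fs Fs≤d ⟩
    d * factorialSum 1 (length Fs)      ≤⟨ *-monoʳ-≤ d (factorialSum-≤ (length Fs)) ⟩
    d * (4 * length Fs !)               ≡⟨ *-assoc d 4 _ ⟨
    d * 4 * length Fs !                 <⟨ *-monoˡ-< (length Fs !) {{length Fs !≢0}} 4d<|R| ⟩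
    length R * length Fs !              ≡⟨ cong (_* length Fs !) |R|≡ ⟩
    suc (length Fs) !                   ≡⟨ cong _! |R|≡ ⟨
    length R !                          ∎)
    where open ≤-Reasoning

  prefixEnd : List A → ℕ → A
  prefixEnd l i = end ε (take i l)

  prefixEnd-length : ∀ l {i} → length l ≤ i → prefixEnd l i ≡ end ε l
  prefixEnd-length l l≤i = cong (end ε) (take-all _ l l≤i)

  shiftBack : A → List A → List A
  shiftBack s = map ((s ⁻¹) ∙_)

  ∉-shiftBack : ∀ {s x F} → x ∉ₗ shiftBack s F → (s ∙ x) ∉ₗ F
  ∉-shiftBack {s} {x} x∉ s∙x∈ = x∉ (subst (_∈ₗ _) (\\-leftDividesʳ s x) (∈-map⁺ ((s ⁻¹) ∙_) s∙x∈))

  -- `N j` stands for the neighbours of vertex j, numbered from 1, so vertex j goes with the prefix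
  -- of j terms. Pairs with i < j are enough since adjacency is symmetric.
  Separated : (ℕ → List ℕ) → List A → Set
  Separated N l = ∀ {i j} → 0 < i → i < j → j ≤ length l → i ∈ₗ N j → prefixEnd l i ≢ prefixEnd l j

  -- Construction of the ordering in three stages: greedy placement, absorption, last block.

  module Ordering (N : ℕ → List ℕ) (d : ℕ) (|N|≤d : ∀ t → length (N t) ≤ d)
    (L : List A) (unique : Unique L) (nonzero : All (_≢ ε) L) where

    total : A
    total = end ε L

    -- A proper prefix that ends at the total sum is ruled out from the start,
    -- so that the last vertex imposes no condition later.
    record Good (l : List A) : Set where
      field
        separated : Separated N l
        incomplete : ∀ {i} → 0 < i → i ≤ length l → prefixEnd l i ≢ total

    open Good

    Good-[] : Good []
    Good-[] = record
      { separated  = λ { _ () z≤n }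
      ; incomplete = λ { () z≤n }
      }

    -- The demands on the new prefix are hypotheses because they are met in two ways: a greedy
    -- choice avoids a list, while an absorbed element is forced and needs its predecessor to be
    -- chosen well.
    Good-∷ʳ : ∀ {l x} → Good l →
              (∀ {i} → i ≤ length l → i ∈ₗ N (suc (length l)) → prefixEnd l i ≢ end ε l ∙ x) →
              end ε l ∙ x ≢ total → Good (l ++ [ x ])
    Good-∷ʳ {l} {x} good new new-incomplete = record { separated = separated-∷ʳ ; incomplete = incomplete-∷ʳ }
      where
      |l∷ʳx| : length (l ++ [ x ]) ≡ suc (length l)
      |l∷ʳx| = trans (length-++ l) (+-comm (length l) 1)

      old : ∀ {i} → i ≤ length l → prefixEnd (l ++ [ x ]) i ≡ prefixEnd l i
      old = end-take-++ˡ ε l [ x ]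

      last : prefixEnd (l ++ [ x ]) (suc (length l)) ≡ end ε l ∙ x
      last = trans (cong (prefixEnd (l ++ [ x ])) (+-comm 1 (length l))) (end-take-++ʳ ε l [ x ] 1)

      separated-∷ʳ : Separated N (l ++ [ x ])
      separated-∷ʳ 0<i i<j j≤ i∈ eq with m≤n⇒m<n∨m≡n (subst (_ ≤_) |l∷ʳx| j≤)
      ... | inj₁ (s≤s j≤l) = good .separated 0<i i<j j≤l i∈ (trans (sym (old (≤-trans (<⇒≤ i<j) j≤l))) (trans eq (old j≤l)))
      ... | inj₂ refl      = new (≤-pred i<j) i∈ (trans (sym (old (≤-pred i<j))) (trans eq last))

      incomplete-∷ʳ : ∀ {i} → 0 < i → i ≤ length (l ++ [ x ]) → prefixEnd (l ++ [ x ]) i ≢ total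
      incomplete-∷ʳ 0<i i≤ eq with m≤n⇒m<n∨m≡n (subst (_ ≤_) |l∷ʳx| i≤)
      ... | inj₁ (s≤s i≤l) = good .incomplete 0<i i≤l (trans (sym (old i≤l)) eq)
      ... | inj₂ refl      = new-incomplete (trans (sym last) eq)

    -- An entry of `N t` beyond `length l` adds the end of l as a forbidden value, which stays
    -- within the bound suc d.
    forbidden : List A → ℕ → List A
    forbidden l t = total ∷ map (prefixEnd l) (N t)

    length-shiftBack-forbidden : ∀ s l t → length (shiftBack s (forbidden l t)) ≤ suc d
    length-shiftBack-forbidden s l t = s≤s (subst (_≤ d)
      (sym (trans (length-map _ (map (prefixEnd l) (N t))) (length-map _ (N t)))) (|N|≤d t))

    Good-∷ʳ-allowed : ∀ {l x} → Good l → (end ε l ∙ x) ∉ₗ forbidden l (suc (length l)) → Good (l ++ [ x ])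
    Good-∷ʳ-allowed {l} good ∉F = Good-∷ʳ good
      (λ _ i∈ eq → ∉F (there (subst (_∈ₗ map (prefixEnd l) (N (suc (length l)))) eq (∈-map⁺ (prefixEnd l) i∈)))) (λ eq → ∉F (here eq))

    -- As long as more than suc d elements remain in `Q`, one of them avoids the at most suc d
    -- forbidden values. `n` bounds the number of rounds.
    place-greedily : ∀ n {l Q R} → length Q ≤ n → Good l → l ++ Q ++ R ↭ L →
                     ∃₂ λ l′ Q′ → length Q′ ≤ suc d × Good l′ × l′ ++ Q′ ++ R ↭ L
    place-greedily zero            Q≤n good ↭L = _ , _ , ≤-trans Q≤n z≤n , good , ↭L
    place-greedily (suc n) {l} {Q} {R} Q≤n good ↭L with length Q ≤? suc d
    ... | yes Q≤d = l , Q , Q≤d , good , ↭L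
    ... | no  Q≰d
      with x , Q′ , Q↭ , x∉ ← pick-avoiding _≟_ {Q} {shiftBack (end ε l) (forbidden l (suc (length l)))}
             (Unique-++ˡ Q (Unique-++ʳ l (Unique-resp-↭ (↭-sym ↭L) unique)))
             (≤-<-trans (length-shiftBack-forbidden (end ε l) l (suc (length l))) (≰⇒> Q≰d))
      = place-greedily n {l ++ [ x ]} {Q′} {R} (≤-pred (subst (_≤ suc n) (↭-length Q↭) Q≤n))
          (Good-∷ʳ-allowed good (∉-shiftBack x∉))
          (↭-trans (↭-reflexive (++-assoc l [ x ] (Q′ ++ R))) (↭-trans (++⁺ˡ l (++⁺ʳ R (↭-sym Q↭))) ↭L))

    blocked₁ : List A → List A
    blocked₁ l = shiftBack (end ε l) (forbidden l (1 + length l))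

    -- After z and then q the walk is at `(end ε l ∙ q) ∙ z` by commutativity, so the demand on the
    -- second new prefix becomes one on z.
    blocked₂ : List A → A → List A
    blocked₂ l q = shiftBack (end ε l ∙ q) (forbidden l (2 + length l))

    -- Each z must avoid at most 2(d + 1) ≤ k values, and `R` still has more than k elements. Each q
    -- uses up one element of `R`, so at least k survive.
    absorb : ∀ Q {l R} k → suc d + suc d ≤ k → k + length Q ≤ length R → Generic R → Good l → l ++ Q ++ R ↭ L →
             ∃₂ λ l′ R′ → k ≤ length R′ × Generic R′ × Good l′ × l′ ++ R′ ↭ L
    absorb []      {l} {R} k 2d≤k k≤R gen good ↭L = l , R , subst (_≤ length R) (+-identityʳ k) k≤R , gen , good , ↭L
    absorb (q ∷ Q) {l} {R} k 2d≤k k≤R gen good ↭L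
      with z , R′ , R↭ , z∉ ← pick-avoiding _≟_ {R} {blocked₁ l ++ blocked₂ l q}
             (Unique-++ʳ (q ∷ Q) (Unique-++ʳ l (Unique-resp-↭ (↭-sym ↭L) unique)))
             (≤-<-trans (≤-trans (≤-reflexive (length-++ (blocked₁ l))) (≤-trans (+-mono-≤
               (length-shiftBack-forbidden (end ε l) l (1 + length l))
               (length-shiftBack-forbidden (end ε l ∙ q) l (2 + length l))) 2d≤k))
               (<-≤-trans (m<m+n k {suc (length Q)} z<s) k≤R))
      = absorb Q {(l ++ [ z ]) ++ [ q ]} {R′} k 2d≤k
          (≤-pred (subst₂ _≤_ (+-suc k (length Q)) (↭-length R↭) k≤R))
          (Generic-tail (Generic-resp-↭ R↭ gen)) (good₂ (λ z∈ → z∉ (∈-++⁺ˡ z∈)) (λ z∈ → z∉ (∈-++⁺ʳ (blocked₁ l) z∈)))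
          (↭-trans (↭-reflexive (trans (++-assoc (l ++ [ z ]) [ q ] (Q ++ R′)) (++-assoc l [ z ] (q ∷ Q ++ R′))))
            (↭-trans (++⁺ˡ l (↭-trans (↭-sym (shift z (q ∷ Q) R′)) (++⁺ˡ (q ∷ Q) (↭-sym R↭)))) ↭L))
      where
      q≢ε : q ≢ ε
      q≢ε = All.lookup nonzero (∈-resp-↭ ↭L (∈-++⁺ʳ l (here refl)))

      good₂ : ∀ {z} → z ∉ₗ blocked₁ l → z ∉ₗ blocked₂ l q → Good ((l ++ [ z ]) ++ [ q ])
      good₂ {z} z∉₁ z∉₂ = Good-∷ʳ (Good-∷ʳ-allowed good (∉-shiftBack z∉₁)) new new-incomplete
        where
        |l∷ʳz| : length (l ++ [ z ]) ≡ suc (length l)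
        |l∷ʳz| = trans (length-++ l) (+-comm (length l) 1)

        end-q : end ε (l ++ [ z ]) ∙ q ≡ (end ε l ∙ q) ∙ z
        end-q = trans (cong (_∙ q) (foldl-++ _∙_ ε l [ z ])) (right-comm (end ε l) z q)

        new-incomplete : end ε (l ++ [ z ]) ∙ q ≢ total
        new-incomplete eq = ∉-shiftBack z∉₂ (here (trans (sym end-q) eq))

        new : ∀ {i} → i ≤ length (l ++ [ z ]) → i ∈ₗ N (suc (length (l ++ [ z ]))) →
              prefixEnd (l ++ [ z ]) i ≢ end ε (l ++ [ z ]) ∙ q
        new {i} i≤ i∈ eq with m≤n⇒m<n∨m≡n i≤
        -- The prefix ending in z is not covered by `blocked₂`; `q ≢ ε` separates it from its
        -- successor.
        ... | inj₂ refl = q≢ε (x∙y≡x⇒y≡ε (trans (sym eq) (prefixEnd-length (l ++ [ z ]) ≤-refl)))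
        ... | inj₁ i<   = ∉-shiftBack z∉₂ (there (subst (_∈ₗ _)
                (trans (sym (end-take-++ˡ ε l [ z ] (≤-pred (subst (i <_) |l∷ʳz| i<)))) (trans eq end-q))
                (∈-map⁺ (prefixEnd l) (subst (λ t → i ∈ₗ N (suc t)) |l∷ʳz| i∈))))

    -- These lists serve the edges that lead from the last block back into l; edges within the block
    -- are left to genericity.
    levels : List A → ℕ → ℕ → List (List A)
    levels l k zero    = []
    levels l k (suc m) = map (prefixEnd l) (N k) ∷ levels l (suc k) m

    length-levels : ∀ l k m → length (levels l k m) ≡ m
    length-levels l k zero    = refl
    length-levels l k (suc m) = cong suc (length-levels l (suc k) m)

    levels-≤ : ∀ l k m → All (λ F → length F ≤ d) (levels l k m)
    levels-≤ l k zero    = []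
    levels-≤ l k (suc m) = subst (_≤ d) (sym (length-map _ (N k))) (|N|≤d k) ∷ levels-≤ l (suc k) m

    Avoids-levels : ∀ {s r l k m i j} → Avoids s r (levels l k m) → j < m → i ∈ₗ N (k + j) →
                    prefixEnd l i ≢ end s (take (suc j) r)
    Avoids-levels {r = x ∷ r} {l} {k} {suc m} {i} {zero}  (∉F , _)    _         i∈ eq =
      ∉F (subst (_∈ₗ _) eq (∈-map⁺ (prefixEnd l) (subst (λ t → i ∈ₗ N t) (+-identityʳ k) i∈)))
    Avoids-levels {r = x ∷ r} {l} {k} {suc m} {i} {suc j} (_ , avoid) (s≤s j<m) i∈ =
      Avoids-levels avoid j<m (subst (λ t → i ∈ₗ N t) (+-suc k j) i∈)

    -- For an edge i < j there are four cases: both ends in l (`separated`), i in l and j beyond l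
    -- but not last (`Avoids`), i in l and j last (`incomplete`), both beyond l (genericity). So
    -- only the first length R - 1 sums of the block need lists.
    finish : ∀ {l R} → d * 4 < length R → Generic R → Good l → l ++ R ↭ L → ∃ λ w → w ↭ L × Separated N w
    finish {l} {R@(_ ∷ R₀)} 4d<R gen good ↭L
      with r , r↭ , avoids ← generic-avoiding-ordering gen (end ε l) (levels l (suc (length l)) (length R₀))
             (cong suc (sym (length-levels l _ (length R₀)))) 4d<R (levels-≤ l _ (length R₀))
      = l ++ r , w↭L r↭ , separated-++ r↭ avoids
      where
      w↭L : ∀ {r} → r ↭ R → l ++ r ↭ L
      w↭L r↭ = ↭-trans (++⁺ˡ l r↭) ↭L

      separated-++ : ∀ {r} → r ↭ R → Avoids (end ε l) r (levels l (suc (length l)) (length R₀)) → Separated N (l ++ r)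
      separated-++ {r} r↭ avoids {i} {j} 0<i i<j j≤w i∈ eq with j ≤? length l
      ... | yes j≤l = good .separated 0<i i<j j≤l i∈
              (trans (sym (end-take-++ˡ ε l r (≤-trans (<⇒≤ i<j) j≤l))) (trans eq (end-take-++ˡ ε l r j≤l)))
      ... | no  j≰l
        with j′ , refl ← m≤n⇒∃[o]m+o≡n (≰⇒> j≰l)
        = later (i ≤? length l)
        where
        j′<R : suc j′ ≤ length R
        j′<R = +-cancelˡ-≤ (length l) _ _ (subst₂ _≤_ (sym (+-suc (length l) j′))
                 (trans (length-++ l) (cong (length l +_) (↭-length r↭))) j≤w)

        end-j : prefixEnd (l ++ r) j ≡ end (end ε l) (take (suc j′) r)
        end-j = trans (cong (prefixEnd (l ++ r)) (sym (+-suc (length l) j′))) (end-take-++ʳ ε l r (suc j′))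

        later : Dec (i ≤ length l) → ⊥
        later (yes i≤l) with m≤n⇒m<n∨m≡n j′<R
        ... | inj₁ (s≤s j′<R₀) = Avoids-levels avoids j′<R₀ i∈ (trans (sym (end-take-++ˡ ε l r i≤l)) (trans eq end-j))
        -- Here j is the last vertex, so its prefix is the whole list, whose sum is `total` in any
        -- order.
        ... | inj₂ refl = good .incomplete 0<i i≤l (trans (sym (end-take-++ˡ ε l r i≤l)) (trans eq (trans end-j
                (trans (cong (end (end ε l)) (take-all _ r (≤-reflexive (↭-length r↭))))
                  (trans (sym (foldl-++ _∙_ ε l r)) (end-↭ ε (w↭L r↭)))))))
        later (no  i≰l)
          with i′ , refl ← m≤n⇒∃[o]m+o≡n (≰⇒> i≰l)
          = Generic⇒end-take-≢ (Generic-resp-↭ (↭-sym r↭) gen) (end ε l)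
              (+-cancelˡ-< (length l) _ _ (subst₂ _<_ (sym (+-suc (length l) i′)) (sym (+-suc (length l) j′)) i<j))
              (subst (suc j′ ≤_) (sym (↭-length r↭)) j′<R)
              (trans (sym (trans (cong (prefixEnd (l ++ r)) (sym (+-suc (length l) i′))) (end-take-++ʳ ε l r (suc i′))))
                (trans eq end-j))

    separated-ordering : ∀ k → suc d * 4 + suc d ≤ k → k + 2 ^ k * 2 ^ k ≤ length L → ∃ λ w → w ↭ L × Separated N w
    separated-ordering k ≤k large
      with R , B , L↭ , |R|≡ , gen ← generic-sublist k unique large
      with l , Q , Q≤ , good , ↭L ← place-greedily (length B) {[]} {B} {R} ≤-refl Good-[] (↭-trans (++-comm B R) (↭-sym L↭))
      -- `Q` costs at most suc d elements of `R`, which leaves at least suc d * 4, more than the d *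
      -- 4 of the union bound.
      with l′ , R′ , k≤ , gen′ , good′ , ↭L′ ← absorb Q {l} {R} (suc d * 4)
             (≤-trans (≤-reflexive (trans (cong (suc d +_) (sym (+-identityʳ (suc d)))) (*-comm 2 (suc d))))
               (*-monoʳ-≤ (suc d) {2} {4} (s≤s (s≤s z≤n))))
             (≤-trans (+-monoʳ-≤ (suc d * 4) Q≤) (≤-trans ≤k (≤-reflexive (sym |R|≡)))) gen good ↭L
      = finish (<-≤-trans (*-monoˡ-< 4 (n<1+n d)) k≤) gen′ good′ ↭L′

-- Subsets and vectors as lists.

Unique⇒lookup-injective : ∀ {A : Set} {xs : List A} → Unique xs → Injective _≡_ _≡_ (lookup xs)
Unique⇒lookup-injective (_ ∷ u)    {zero}  {zero}  eq = refl
Unique⇒lookup-injective (x∉xs ∷ _) {zero}  {suc j} eq = contradiction eq (All.lookup x∉xs (∈-lookup j))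
Unique⇒lookup-injective (x∉xs ∷ _) {suc i} {zero}  eq = contradiction (sym eq) (All.lookup x∉xs (∈-lookup i))
Unique⇒lookup-injective (_ ∷ u)    {suc i} {suc j} eq = cong suc (Unique⇒lookup-injective u eq)

elements : ∀ {n} → Subset n → List (Fin n)
elements []          = []
elements (true ∷ A)  = zero ∷ map suc (elements A)
elements (false ∷ A) = map suc (elements A)

length-elements : ∀ {n} (A : Subset n) → length (elements A) ≡ ∣ A ∣
length-elements []          = refl
length-elements (true ∷ A)  = cong suc (trans (length-map suc (elements A)) (length-elements A))
length-elements (false ∷ A) = trans (length-map suc (elements A)) (length-elements A)

∈-elements⁺ : ∀ {n} {A : Subset n} {x} → x ∈ A → x ∈ₗ elements A
∈-elements⁺ {A = true ∷ A}  Vec.here       = here refl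
∈-elements⁺ {A = true ∷ A}  (Vec.there x∈) = there (∈-map⁺ suc (∈-elements⁺ x∈))
∈-elements⁺ {A = false ∷ A} (Vec.there x∈) = ∈-map⁺ suc (∈-elements⁺ x∈)

∈-elements⁻ : ∀ {n} (A : Subset n) {x} → x ∈ₗ elements A → x ∈ A
∈-elements⁻ (true ∷ A) (here refl) = Vec.here
∈-elements⁻ (true ∷ A) (there x∈) with _ , y∈ , refl ← ∈-map⁻ suc x∈ = Vec.there (∈-elements⁻ A y∈)
∈-elements⁻ (false ∷ A) x∈        with _ , y∈ , refl ← ∈-map⁻ suc x∈ = Vec.there (∈-elements⁻ A y∈)

Unique-elements : ∀ {n} (A : Subset n) → Unique (elements A)
Unique-elements []          = []
Unique-elements (true ∷ A)  = All.tabulate zero∉ ∷ Unique.map⁺ Fin.suc-injective (Unique-elements A)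
  where
  zero∉ : ∀ {x} → x ∈ₗ map suc (elements A) → zero ≢ x
  zero∉ x∈ refl with () ← proj₂ (proj₂ (∈-map⁻ suc x∈))
Unique-elements (false ∷ A) = Unique.map⁺ Fin.suc-injective (Unique-elements A)

length-filter-tabulate : ∀ {A : Set} {P : Pred A 0ℓ} (P? : Unary.Decidable P) {n} (f : Fin n → A) →
                         length (filter P? (tabulate f)) ≡ Vec.count P? (Vec.tabulate f)
length-filter-tabulate P? {zero}  f = refl
length-filter-tabulate P? {suc n} f with does (P? (f zero))
... | true  = cong suc (length-filter-tabulate P? (f ∘ suc))
... | false = length-filter-tabulate P? (f ∘ suc)

≤-foldr-⊔ : ∀ {n} (f : Vector ℕ n) i → f i ≤ foldr _⊔_ 0 f
≤-foldr-⊔ f zero    = m≤m⊔n _ _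
≤-foldr-⊔ f (suc i) = ≤-trans (≤-foldr-⊔ (f ∘ suc) i) (m≤n⊔m (f zero) _)

-- Neighbour lists of a graph.

module _ {n} (Γ : SimpleGraph n) where
  open SimpleGraph Γ

  -- Vertices are numbered from 1 here, as in the paper.
  neighbours : ℕ → List ℕ
  neighbours zero    = []
  neighbours (suc t) with t <? n
  ... | yes t<n = map (suc ∘ toℕ) (filter (fromℕ< t<n ~?_) (allFin n))
  ... | no  _   = []

  length-neighbours : ∀ t → length (neighbours t) ≤ maxDegree
  length-neighbours zero    = z≤n
  length-neighbours (suc t) with t <? n
  ... | yes t<n = ≤-trans (≤-reflexive (trans (length-map _ (filter (fromℕ< t<n ~?_) (allFin n)))
                    (length-filter-tabulate (fromℕ< t<n ~?_) id))) (≤-foldr-⊔ degree (fromℕ< t<n))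
  ... | no  _   = z≤n

  ∈-neighbours : ∀ {i j} → i ~ j → suc (toℕ i) ∈ₗ neighbours (suc (toℕ j))
  ∈-neighbours {i} {j} i~j with toℕ j <? n
  ... | yes j<n = ∈-map⁺ (suc ∘ toℕ) (∈-filter⁺ (fromℕ< j<n ~?_) (∈-allFin i)
                    (subst (_~ i) (sym (Fin.fromℕ<-toℕ j j<n)) (~-sym i~j)))
  ... | no  j≮n = contradiction (Fin.toℕ<n j) j≮n

-- Transfer to cyclic groups and the theorem.

module _ (m : ℕ) .{{_ : NonZero m}} where
  private
    G = ℤ/ m
  open Group G using (_∙_; ε; assoc; identityˡ; identityʳ)

  ℤ/-isAbelianGroup : IsAbelianGroup _≡_ _∙_ ε (Group._⁻¹ G)
  ℤ/-isAbelianGroup = record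
    { isGroup = Group.isGroup G
    ; comm    = λ x y → cong (_mod m) (+-comm (toℕ x) (toℕ y))
    }

  open Sequencing ℤ/-isAbelianGroup Fin._≟_

  -- `sum` associates to the right and `end` to the left; the free start s lets associativity move
  -- one term at a time.
  partialSum-lookup : ∀ s w (i : Fin (suc (length w))) → s ∙ partialSum G (lookup w) i ≡ end s (take (toℕ i) w)
  partialSum-lookup s w       zero    = identityʳ s
  partialSum-lookup s (x ∷ w) (suc i) = trans (sym (assoc s x _)) (partialSum-lookup (s ∙ x) w i)

  partialSum≡prefixEnd : ∀ w i → partialSum G (lookup w) i ≡ prefixEnd w (toℕ i)
  partialSum≡prefixEnd w i = trans (sym (identityˡ _)) (partialSum-lookup ε w i)

  separated⇒sequenceable : ∀ {n} (Γ : SimpleGraph n) (A : Subset m) w → length w ≡ n → w ↭ elements A →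
                           Separated (neighbours Γ) w → Sequenceable G Γ (_∈ A)
  separated⇒sequenceable Γ A w refl w↭A separated = lookup w , isOrdering , edge
    where
    open SimpleGraph Γ

    isOrdering : IsOrdering G (_∈ A) (lookup w)
    isOrdering = record
      { distinct   = Unique⇒lookup-injective (Unique-resp-↭ (↭-sym w↭A) (Unique-elements A))
      ; sound      = λ i → ∈-elements⁻ A (∈-resp-↭ w↭A (∈-lookup i))
      ; exhaustive = λ x∈A → let x∈w = ∈-resp-↭ (↭-sym w↭A) (∈-elements⁺ x∈A) in
                     index x∈w , sym (lookup-index x∈w)
      }

    forward : ∀ {i j} → i ~ j → toℕ i < toℕ j → partialSum G (lookup w) (suc i) ≢ partialSum G (lookup w) (suc j)
    forward {i} {j} i~j i<j eq = separated z<s (s≤s i<j) (Fin.toℕ<n j) (∈-neighbours Γ i~j)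
      (trans (sym (partialSum≡prefixEnd w (suc i))) (trans eq (partialSum≡prefixEnd w (suc j))))

    edge : ∀ {i j} → i ~ j → partialSum G (lookup w) (suc i) ≢ partialSum G (lookup w) (suc j)
    edge {i} {j} i~j eq with <-cmp (toℕ i) (toℕ j)
    ... | tri< i<j _ _ = forward i~j i<j eq
    ... | tri≈ _ i≡j _ = ~-irr (Fin.toℕ-injective i≡j) i~j
    ... | tri> _ _ j<i = forward (~-sym i~j) j<i (sym eq)

  sequenceable : ∀ {d n} k → suc d * 4 + suc d ≤ k → k + 2 ^ k * 2 ^ k ≤ n →
                 (Γ : SimpleGraph n) → SimpleGraph.maxDegree Γ ≤ d →
                 (A : Subset m) → ∣ A ∣ ≡ n → ε ∉ A → Sequenceable G Γ (_∈ A)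
  sequenceable {d} {n} k ≤k large Γ Δ≤d A |A|≡n ε∉A
    with w , w↭A , separated ← Ordering.separated-ordering (neighbours Γ) d
           (λ t → ≤-trans (length-neighbours Γ t) Δ≤d) (elements A) (Unique-elements A)
           (All.tabulate λ x∈ x≡ε → ε∉A (subst (_∈ A) x≡ε (∈-elements⁻ A x∈)))
           k ≤k (subst (k + 2 ^ k * 2 ^ k ≤_) (sym (trans (length-elements A) |A|≡n)) large)
    = separated⇒sequenceable Γ A w (trans (↭-length w↭A) (trans (length-elements A) |A|≡n)) w↭A separated

theorem5p4 : ∀ (d : ℕ) → 0 < d → ∃ λ (N : ℕ) →
    ∀ (n : ℕ) → N ≤ n →
    ∀ (Γ : SimpleGraph n) → SimpleGraph.maxDegree Γ ≤ d →
    ∀ (p : ℕ) (p-prime : Prime p) → n ^ 2 < p →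
    let ℤₚ = ℤ/ p {{prime⇒nonZero p-prime}} in
    ∀ (A : Subset p) → ∣ A ∣ ≡ n → Group.ε ℤₚ ∉ A →
    Sequenceable ℤₚ Γ (_∈ A)
theorem5p4 d _ = k + 2 ^ k * 2 ^ k , λ n large Γ Δ≤d p p-prime _ →
  sequenceable p {{prime⇒nonZero p-prime}} k ≤-refl large Γ Δ≤d
  -- 4(d + 1) elements for the last block and d + 1 for absorption; `k + 2 ^ k * 2 ^ k` is what
  -- `generic-sublist` asks for at reserve size k.
  where k = suc d * 4 + suc d
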